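{- For every $n\ge 1$, the set $\mathcal{U}_n$ of unimodal permutations in $\mathcal{S}_n$ satisfies $$\mathcal{U}_n=\mathcal{A}_n(2143,3412)=\mathcal{S}_n(1324,1342,2143,2413,2431,3124,3142,3412,4213,4231).$$
   Context: Permutations $\pi\in\mathcal{S}_n$ are written in one-line notation. An interval in $\mathbb{Z}$ is a set $[a,b]=\{a,a+1,\dots,b\}$ with $a\le b$. An interval in $\mathbb{Z}_n$ is a subset of $\{1,\dots,n\}$ of the form $[a,b]$ or $[b,n]\cup[1,a]$ for some $1\le a\le b\le n$. A permutation $\pi\in\mathcal{S}_n$ is unimodal if either (i) for every $1\le j\le n$ the set of letters of the prefix $\pi(1)\cdots\pi(j)$ is an interval in $\mathbb{Z}$, or (ii) for every $1\le j\le n$ the set of letters of the suffix $\pi(j)\cdots\pi(n)$ is an interval in $\mathbb{Z}$. $\mathcal{U}_n$ is the set of unimodal permutations in $\mathcal{S}_n$. A permutation is an arc permutation if for every $1\le j\le n$ the set $\{\pi(1),\dots,\pi(j)\}$ is an interval in $\mathbb{Z}_n$; $\mathcal{A}_n$ is the set of arc permutations in $\mathcal{S}_n$. For patterns $\tau_1,\tau_2,\dots$, $\mathcal{S}_n(\tau_1,\tau_2,\dots)$ (resp. $\mathcal{A}_n(\tau_1,\tau_2,\dots)$) denotes the set of permutations in $\mathcal{S}_n$ (resp. $\mathcal{A}_n$) that avoid all of the $\tau_i$, i.e. contain no (not necessarily contiguous) subsequence whose entries are in the same relative order as those of $\tau_i$. -}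

module Defs where

open import Data.Fin.Base using (Fin; _≤_; _<_)
open import Data.Fin.Permutation using (Permutation′; _⟨$⟩ʳ_)
open import Data.List.Base using (List; []; _∷_; length; lookup)
open import Data.List.Relation.Unary.All using (All)
open import Data.Nat.Base as ℕ using (ℕ)
open import Data.Product.Base using (∃-syntax; Σ-syntax; _×_)
open import Data.Sum.Base using (_⊎_)
open import Function.Bundles using (_⇔_)
open import Level using (0ℓ)
open import Relation.Binary.PropositionalEquality.Core using (_≡_)
open import Relation.Nullary.Negation.Core using (¬_)
open import Relation.Unary using (Pred; _≐_; _∪_; _∩_)

-- Positions and letters 1, …, n are represented by Fin n, so the letter k is
-- the element whose toℕ is k ∸ 1, and π(i) is π ⟨$⟩ʳ i.

Letters : ℕ → Set₁
Letters n = Pred (Fin n) 0ℓ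

prefixLetters : ∀ {n} → Permutation′ n → Fin n → Letters n
prefixLetters π j x = ∃[ i ] (i ≤ j × π ⟨$⟩ʳ i ≡ x)

suffixLetters : ∀ {n} → Permutation′ n → Fin n → Letters n
suffixLetters π j x = ∃[ i ] (j ≤ i × π ⟨$⟩ʳ i ≡ x)

[_⋯_] : ∀ {n} → Fin n → Fin n → Letters n
[ a ⋯ b ] x = a ≤ x × x ≤ b

[_⋯n] : ∀ {n} → Fin n → Letters n
[ b ⋯n] x = b ≤ x

[1⋯_] : ∀ {n} → Fin n → Letters n
[1⋯ a ] x = x ≤ a

-- The endpoints of an interval [a,b] of ℤ with a ≤ b belong to it, so for a
-- set of letters they may be taken to be letters.
IsIntervalℤ : ∀ {n} → Letters n → Set
IsIntervalℤ P = ∃[ a ] ∃[ b ] (a ≤ b × P ≐ [ a ⋯ b ])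

IsIntervalℤₙ : ∀ {n} → Letters n → Set
IsIntervalℤₙ P =
  ∃[ a ] ∃[ b ] (a ≤ b × (P ≐ [ a ⋯ b ] ⊎ P ≐ [ b ⋯n] ∪ [1⋯ a ]))

𝒰 : ∀ n → Pred (Permutation′ n) 0ℓ
𝒰 n π = (∀ j → IsIntervalℤ (prefixLetters π j))
      ⊎ (∀ j → IsIntervalℤ (suffixLetters π j))

𝒜 : ∀ n → Pred (Permutation′ n) 0ℓ
𝒜 n π = ∀ j → IsIntervalℤₙ (prefixLetters π j)

-- A pattern in one-line notation; only the relative order of its entries
-- matters.
Pattern : Set
Pattern = List ℕ

-- p picks the positions of the subsequence.
Contains : ∀ {n} → Permutation′ n → Pattern → Set
Contains {n} π τ =
  Σ[ p ∈ (Fin (length τ) → Fin n) ]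
    (∀ s t → s < t → p s < p t) ×
    (∀ s t → lookup τ s ℕ.< lookup τ t ⇔ π ⟨$⟩ʳ p s < π ⟨$⟩ʳ p t)

𝒮⟨_⟩ : List Pattern → ∀ n → Pred (Permutation′ n) 0ℓ
𝒮⟨ τs ⟩ n π = All (λ τ → ¬ Contains π τ) τs

𝒜⟨_⟩ : List Pattern → ∀ n → Pred (Permutation′ n) 0ℓ
𝒜⟨ τs ⟩ n = 𝒜 n ∩ 𝒮⟨ τs ⟩ n

⟪_,_,_,_⟫ : ℕ → ℕ → ℕ → ℕ → Pattern
⟪ a , b , c , d ⟫ = a ∷ b ∷ c ∷ d ∷ []

{-# OPTIONS --safe #-}
-- Unimodality means that no letter lies strictly between two letters to its
-- left (every prefix is convex), or that no letter lies strictly between two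
-- letters to its right.  Suppose π avoids the ten patterns.  If the first
-- letter is extreme, prepending it to a violation of the second condition gives
-- 1324, 1342, 4213 or 4231; if the last letter is extreme, appending it to a
-- violation of the first gives 1324, 3124, 2431 or 4231.  If neither is extreme,
-- some letter lies below both and some letter above both, and the four letters
-- form 2143, 2413, 3142 or 3412.
--
-- For arc permutations: an interval of ℤₙ cannot contain x < z without
-- containing y or w, when x < y < z and w is outside [x,z].  This excludes the
-- eight patterns whose first two entries differ by 2.  Conversely,
-- if no letter lies strictly between two letters to its right, then every prefix
-- has convex complement and so is an interval of ℤₙ.
module Submission where

open import Defs
open import Data.List.Base using ([]; _∷_)
open import Data.Nat.Base using (ℕ; _≤_)
open import Data.Product.Base using (_×_)
open import Relation.Unary using (_≐_)

open import Data.Fin.Base as Fin using (Fin; zero; suc; toℕ; fromℕ)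
open import Data.Fin.Patterns using (0F; 1F; 2F; 3F)
open import Data.Fin.Permutation using (Permutation′; _⟨$⟩ʳ_; _⟨$⟩ˡ_; inverseʳ)
open import Data.Fin.Properties as Fin
  using (_≟_; _≤?_; _<?_; <-cmp; ≤∧≢⇒<; ≤fromℕ; any?; all?)
open import Data.List.Base using (List; length; lookup)
open import Data.List.Relation.Unary.All using ([]; _∷_)
import Data.Nat.Base as ℕ
import Data.Nat.Properties as ℕ
open import Data.Product.Base using (_,_; ∃-syntax; proj₁; proj₂)
open import Data.Sum.Base as Sum using (_⊎_; inj₁; inj₂)
open import Data.Vec.Base as Vec using (Vec; []; _∷_)
open import Data.Vec.Relation.Unary.Linked using (Linked; [-]; _∷_)
open import Data.Vec.Relation.Unary.Linked.Properties using (lookup⁺)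
open import Function.Base using (_∘_)
open import Function.Bundles using (Equivalence; Injection; mk⇔)
open import Function.Properties.Inverse using (↔⇒↣)
open import Relation.Binary.Definitions using (tri<; tri≈; tri>)
open import Relation.Binary.PropositionalEquality
  using (_≡_; _≢_; refl; sym; trans; subst; subst₂)
open import Relation.Nullary using (¬_; yes; no; contradiction)
open import Relation.Nullary.Decidable
  using (True; toWitness; _×-dec_; _⊎-dec_; ¬?; decidable-stable)
open import Relation.Unary using (Decidable; ∁)

private
  variable
    n : ℕ
    P : Letters n

-- Intervals of ℤ and ℤₙ through convexity.

least : Decidable P → ∃[ x ] P x → ∃[ a ] (P a × ∀ {y} → P y → a Fin.≤ y)
least {ℕ.suc n} {P} P? (x , px) with P? zero
... | yes p0 = zero , p0 , λ _ → ℕ.z≤n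
... | no ¬p0 with least (P? ∘ suc) (predecessor x px)
  where
  predecessor : ∀ x → P x → ∃[ y ] P (suc y)
  predecessor zero    p0 = contradiction p0 ¬p0
  predecessor (suc y) py = y , py
...   | a , pa , a≤ = suc a , pa , λ { {zero} p0 → contradiction p0 ¬p0
                                     ; {suc y} py → ℕ.s≤s (a≤ py) }

greatest : Decidable P → ∃[ x ] P x → ∃[ b ] (P b × ∀ {y} → P y → y Fin.≤ b)
greatest {ℕ.suc n} {P} P? (x , px) with any? (P? ∘ suc)
... | yes ∃p = let b , pb , ≤b = greatest (P? ∘ suc) ∃p in
  suc b , pb , λ { {zero} _ → ℕ.z≤n ; {suc y} py → ℕ.s≤s (≤b py) }
... | no ¬∃p = zero , at-zero x px , λ { {zero} _ → ℕ.z≤n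
                                       ; {suc y} py → contradiction (y , py) ¬∃p }
  where
  at-zero : ∀ x → P x → P zero
  at-zero zero    p0 = p0
  at-zero (suc y) py = contradiction (y , py) ¬∃p

Convex : Letters n → Set
Convex P = ∀ {x y z} → P x → P z → x Fin.< y → y Fin.< z → P y

intervalℤ⇒convex : IsIntervalℤ P → Convex P
intervalℤ⇒convex (a , b , _ , P⊆ , ⊆P) px pz x<y y<z =
  ⊆P ( ℕ.≤-trans (proj₁ (P⊆ px)) (ℕ.<⇒≤ x<y)
     , ℕ.≤-trans (ℕ.<⇒≤ y<z) (proj₂ (P⊆ pz)))

convex⇒intervalℤ : Decidable P → ∃[ x ] P x → Convex P → IsIntervalℤ P
convex⇒intervalℤ {P = P} P? ∃p conv with least P? ∃p | greatest P? ∃p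
... | a , pa , a≤ | b , pb , ≤b =
  a , b , a≤ pb , (λ px → a≤ px , ≤b px) , λ (a≤x , x≤b) → fill a≤x x≤b
  where
  fill : ∀ {x} → a Fin.≤ x → x Fin.≤ b → P x
  fill {x} a≤x x≤b with x ≟ a | x ≟ b
  ... | yes refl | _        = pa
  ... | _        | yes refl = pb
  ... | no x≢a   | no x≢b   =
    conv pa pb (≤∧≢⇒< a≤x (x≢a ∘ sym)) (≤∧≢⇒< x≤b x≢b)

intervalℤ⇒intervalℤₙ : IsIntervalℤ P → IsIntervalℤₙ P
intervalℤ⇒intervalℤₙ (a , b , a≤b , P≐) = a , b , a≤b , inj₁ P≐

-- If P misses some y between two of its elements, then P is [b,n] ∪ [1,a] for
-- the nearest elements a and b of P on either side of y.
co-convex⇒intervalℤₙ : Decidable P → ∃[ x ] P x → Convex (∁ P) → IsIntervalℤₙ P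
co-convex⇒intervalℤₙ {P = P} P? ∃p conv
  with any? (λ y → ¬? (P? y) ×-dec any? (λ x → P? x ×-dec x <? y)
                             ×-dec any? (λ z → P? z ×-dec y <? z))
... | no ¬gap = intervalℤ⇒intervalℤₙ (convex⇒intervalℤ P? ∃p
  λ {x} {y} {z} px pz x<y y<z → decidable-stable (P? y)
    λ ¬py → ¬gap (y , ¬py , (x , px , x<y) , (z , pz , y<z)))
... | yes (y , ¬py , ∃< , ∃>)
  with greatest (λ x → P? x ×-dec x <? y) ∃< | least (λ z → P? z ×-dec y <? z) ∃>
...   | a , (pa , a<y) , ≤a | b , (pb , y<b) , b≤ =
  a , b , ℕ.<⇒≤ (ℕ.<-trans a<y y<b) , inj₂ (outside , inside)
  where
  outside : ∀ {x} → P x → b Fin.≤ x ⊎ x Fin.≤ a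
  outside {x} px with <-cmp x y
  ... | tri< x<y _ _ = inj₂ (≤a (px , x<y))
  ... | tri≈ _ refl _ = contradiction px ¬py
  ... | tri> _ _ y<x = inj₁ (b≤ (px , y<x))

  inside : ∀ {x} → b Fin.≤ x ⊎ x Fin.≤ a → P x
  -- `y` and a missing `x` beyond `b` would enclose `b`, against convexity of the complement;
  -- likewise below `a`.
  inside {x} (inj₁ b≤x) with b ≟ x
  ... | yes refl = pb
  ... | no b≢x   = decidable-stable (P? x)
    λ ¬px → conv ¬py ¬px y<b (≤∧≢⇒< b≤x b≢x) pb
  inside {x} (inj₂ x≤a) with x ≟ a
  ... | yes refl = pa
  ... | no x≢a   = decidable-stable (P? x)
    λ ¬px → conv ¬px ¬py (≤∧≢⇒< x≤a x≢a) a<y pa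

-- In the wrapping case the complement of `P` is convex, yet `w` and `y` enclose `x` or `z`, an
-- element of `P`.
intervalℤₙ-noncrossing : ∀ {w x y z} → IsIntervalℤₙ P → P x → P z → ¬ P y → ¬ P w →
  x Fin.< y → y Fin.< z → ¬ (w Fin.< x ⊎ z Fin.< w)
intervalℤₙ-noncrossing (a , b , a≤b , inj₁ P≐) px pz ¬py _ x<y y<z _ =
  ¬py (intervalℤ⇒convex (a , b , a≤b , P≐) px pz x<y y<z)
intervalℤₙ-noncrossing {P = P} (a , b , _ , inj₂ (P⊆ , ⊆P)) px pz ¬py ¬pw x<y y<z =
  λ { (inj₁ w<x) → trapped ¬pw ¬py px w<x x<y
    ; (inj₂ z<w) → trapped ¬py ¬pw pz y<z z<w }
  where
  trapped : ∀ {u v t} → ¬ P u → ¬ P v → P t → u Fin.< t → ¬ (t Fin.< v)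
  trapped ¬pu ¬pv pt u<t t<v with P⊆ pt
  ... | inj₁ b≤t = ¬pv (⊆P (inj₁ (ℕ.≤-trans b≤t (ℕ.<⇒≤ t<v))))
  ... | inj₂ t≤a = ¬pu (⊆P (inj₂ (ℕ.≤-trans (ℕ.<⇒≤ u<t) t≤a)))

-- Convexity of prefixes and suffixes.

module _ (π : Permutation′ n) where

  private
    letter-injective : ∀ {i j} → π ⟨$⟩ʳ i ≡ π ⟨$⟩ʳ j → i ≡ j
    letter-injective = Injection.injective (↔⇒↣ π)

  -- `s` and `t` are left unordered, so one condition covers both arrangements of the outer letters.
  PrefixConvex SuffixConvex : Set
  PrefixConvex = ∀ {s t k} → s Fin.< k → t Fin.< k →
    π ⟨$⟩ʳ s Fin.< π ⟨$⟩ʳ k → ¬ (π ⟨$⟩ʳ k Fin.< π ⟨$⟩ʳ t)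
  SuffixConvex = ∀ {i s t} → i Fin.< s → i Fin.< t →
    π ⟨$⟩ʳ s Fin.< π ⟨$⟩ʳ i → ¬ (π ⟨$⟩ʳ i Fin.< π ⟨$⟩ʳ t)

  prefixLetters? : ∀ j → Decidable (prefixLetters π j)
  prefixLetters? j x = any? λ i → i ≤? j ×-dec π ⟨$⟩ʳ i ≟ x

  suffixLetters? : ∀ j → Decidable (suffixLetters π j)
  suffixLetters? j x = any? λ i → j ≤? i ×-dec π ⟨$⟩ʳ i ≟ x

  ∉prefixLetters : ∀ {j k} → j Fin.< k → ¬ prefixLetters π j (π ⟨$⟩ʳ k)
  ∉prefixLetters j<k (i , i≤j , πi≡πk) with refl ← letter-injective πi≡πk =
    ℕ.<⇒≱ j<k i≤j

  ∉suffixLetters : ∀ {i j} → i Fin.< j → ¬ suffixLetters π j (π ⟨$⟩ʳ i)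
  ∉suffixLetters i<j (k , j≤k , πk≡πi) with refl ← letter-injective πk≡πi =
    ℕ.<⇒≱ i<j j≤k

  -- The prefix ending at the later of `s` and `t` contains both outer letters but not the letter at
  -- `k`.
  prefixIntervals⇒prefixConvex : (∀ j → IsIntervalℤ (prefixLetters π j)) → PrefixConvex
  prefixIntervals⇒prefixConvex int {s} {t} s<k t<k πs<πk πk<πt with ℕ.≤-total (toℕ s) (toℕ t)
  ... | inj₁ s≤t = ∉prefixLetters t<k (intervalℤ⇒convex (int t)
    (s , s≤t , refl) (t , ℕ.≤-refl , refl) πs<πk πk<πt)
  ... | inj₂ t≤s = ∉prefixLetters s<k (intervalℤ⇒convex (int s)
    (s , ℕ.≤-refl , refl) (t , t≤s , refl) πs<πk πk<πt)

  suffixIntervals⇒suffixConvex : (∀ j → IsIntervalℤ (suffixLetters π j)) → SuffixConvex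
  suffixIntervals⇒suffixConvex int {s = s} {t} i<s i<t πs<πi πi<πt with ℕ.≤-total (toℕ s) (toℕ t)
  ... | inj₁ s≤t = ∉suffixLetters i<s (intervalℤ⇒convex (int s)
    (s , ℕ.≤-refl , refl) (t , s≤t , refl) πs<πi πi<πt)
  ... | inj₂ t≤s = ∉suffixLetters i<t (intervalℤ⇒convex (int t)
    (s , t≤s , refl) (t , ℕ.≤-refl , refl) πs<πi πi<πt)

  private
    -- Convexity speaks of letters, `PrefixConvex` and `SuffixConvex` of positions; this passes from
    -- a letter to its position.
    letter-elim : (Q : Letters n) → (∀ i → Q (π ⟨$⟩ʳ i)) → ∀ x → Q x
    letter-elim Q q x = subst Q (inverseʳ π) (q (π ⟨$⟩ˡ x))

  prefixConvex⇒prefixIntervals : PrefixConvex → ∀ j → IsIntervalℤ (prefixLetters π j)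
  prefixConvex⇒prefixIntervals conv j =
    convex⇒intervalℤ (prefixLetters? j) (_ , j , ℕ.≤-refl , refl) convex
    where
    convex : Convex (prefixLetters π j)
    convex {y = y} (s , s≤j , refl) (t , t≤j , refl) = letter-elim
      (λ y → π ⟨$⟩ʳ s Fin.< y → y Fin.< π ⟨$⟩ʳ t → prefixLetters π j y)
      -- A position `k` beyond `j` would lie to the right of both `s` and `t`, which `conv` forbids.
      (λ k πs<πk πk<πt → k , ℕ.≮⇒≥ (λ j<k →
        conv (ℕ.≤-<-trans s≤j j<k) (ℕ.≤-<-trans t≤j j<k) πs<πk πk<πt) , refl) y

  suffixConvex⇒suffixIntervals : SuffixConvex → ∀ j → IsIntervalℤ (suffixLetters π j)
  suffixConvex⇒suffixIntervals conv j =
    convex⇒intervalℤ (suffixLetters? j) (_ , j , ℕ.≤-refl , refl) convex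
    where
    convex : Convex (suffixLetters π j)
    convex {y = y} (s , j≤s , refl) (t , j≤t , refl) = letter-elim
      (λ y → π ⟨$⟩ʳ s Fin.< y → y Fin.< π ⟨$⟩ʳ t → suffixLetters π j y)
      (λ i πs<πi πi<πt → i , ℕ.≮⇒≥ (λ i<j →
        conv (ℕ.<-≤-trans i<j j≤s) (ℕ.<-≤-trans i<j j≤t) πs<πi πi<πt) , refl) y

  suffixConvex⇒arc : SuffixConvex → 𝒜 n π
  suffixConvex⇒arc conv j =
    co-convex⇒intervalℤₙ (prefixLetters? j) (_ , j , ℕ.≤-refl , refl)
      -- Letters missing from the prefix stand after `j`, so two of them around a letter of the
      -- prefix violate `conv`.
      λ {x} {y} {z} x∉ z∉ x<y y<z → letter-elim
        (λ x → ¬ prefixLetters π j x → x Fin.< y → ¬ prefixLetters π j y)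
        (λ s πs∉ πs<y → letter-elim
          (λ z → ¬ prefixLetters π j z → y Fin.< z → ¬ prefixLetters π j y)
          (λ { t πt∉ πi<πt (i , i≤j , refl) →
            conv (after i≤j πs∉) (after i≤j πt∉) πs<y πi<πt }) z z∉ y<z) x x∉ x<y
    where
    after : ∀ {i k} → i Fin.≤ j → ¬ prefixLetters π j (π ⟨$⟩ʳ k) → i Fin.< k
    after i≤j πk∉ = ℕ.≤-<-trans i≤j (ℕ.≰⇒> λ k≤j → πk∉ (_ , k≤j , refl))

  -- Occurrences and avoidance of patterns.

  private
    Below : ∀ {k} → Vec (Fin n) k → Fin k → Fin k → Set
    Below ps s t = π ⟨$⟩ʳ Vec.lookup ps s Fin.< π ⟨$⟩ʳ Vec.lookup ps t

  -- o lists the positions of τ by increasing entry, i.e. it is τ⁻¹.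
  occurrence : ∀ {τ} (ps : Vec (Fin n) (length τ)) (o : Vec (Fin (length τ)) (length τ))
    {_ : True (all? λ s → any? λ r → Vec.lookup o r ≟ s ×-dec lookup τ s ℕ.≟ ℕ.suc (toℕ r))} →
    Linked Fin._<_ ps → Linked (Below ps) o → Contains π τ
  occurrence {τ} ps o {ranks} ps↗ letters↗ =
    Vec.lookup ps , (λ _ _ → lookup⁺ ℕ.<-trans ps↗) , λ s t → mk⇔ (to s t) (from s t)
    where
    to : ∀ s t → lookup τ s ℕ.< lookup τ t → Below ps s t
    to s t τs<τt with toWitness ranks s | toWitness ranks t
    ... | r , refl , τs≡ | r′ , refl , τt≡ =
      lookup⁺ ℕ.<-trans letters↗ (ℕ.s<s⁻¹ (subst₂ ℕ._<_ τs≡ τt≡ τs<τt))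

    from : ∀ s t → Below ps s t → lookup τ s ℕ.< lookup τ t
    from s t πs<πt with toWitness ranks s | toWitness ranks t
    -- Ranks count from 0 and entries from 1. As `letters↗` orders letters by rank, equal or
    -- reversed ranks contradict `πs<πt`.
    ... | r , refl , τs≡ | r′ , refl , τt≡ with <-cmp r r′
    ...   | tri< r<r′ _ _ = subst₂ ℕ._<_ (sym τs≡) (sym τt≡) (ℕ.s<s r<r′)
    ...   | tri≈ _ refl _ = contradiction πs<πt (ℕ.<-irrefl refl)
    ...   | tri> _ _ r′<r = contradiction πs<πt (ℕ.<-asym (lookup⁺ ℕ.<-trans letters↗ r′<r))

  -- An occurrence copies a violation found inside `τ` into `π`. For a concrete `τ` the implicit
  -- argument is settled by evaluation.
  prefixConvex⇒avoids : PrefixConvex → ∀ {τ} (s t k : Fin (length τ))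
    {_ : True (s <? k ×-dec t <? k ×-dec
               lookup τ s ℕ.<? lookup τ k ×-dec lookup τ k ℕ.<? lookup τ t)} →
    ¬ Contains π τ
  prefixConvex⇒avoids conv s t k {h} (p , p↗ , order) =
    let s<k , t<k , τs<τk , τk<τt = toWitness h in
    conv (p↗ s k s<k) (p↗ t k t<k)
      (Equivalence.to (order s k) τs<τk) (Equivalence.to (order k t) τk<τt)

  suffixConvex⇒avoids : SuffixConvex → ∀ {τ} (i s t : Fin (length τ))
    {_ : True (i <? s ×-dec i <? t ×-dec
               lookup τ s ℕ.<? lookup τ i ×-dec lookup τ i ℕ.<? lookup τ t)} →
    ¬ Contains π τ
  suffixConvex⇒avoids conv i s t {h} (p , p↗ , order) =
    let i<s , i<t , τs<τi , τi<τt = toWitness h in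
    conv (p↗ i s i<s) (p↗ i t i<t)
      (Equivalence.to (order s i) τs<τi) (Equivalence.to (order i t) τi<τt)

  -- The prefix ending at `p c` holds the letters of `x` and `z` and misses those of `y` and `w`.
  -- Equality with `c` is a separate case because `p` is given to preserve only `<`.
  arc⇒avoids : 𝒜 n π → ∀ {τ} (c w x y z : Fin (length τ))
    {_ : True ((x ≟ c ⊎-dec x <? c) ×-dec (z ≟ c ⊎-dec z <? c) ×-dec c <? y ×-dec c <? w ×-dec
               lookup τ x ℕ.<? lookup τ y ×-dec lookup τ y ℕ.<? lookup τ z ×-dec
               (lookup τ w ℕ.<? lookup τ x ⊎-dec lookup τ z ℕ.<? lookup τ w))} →
    ¬ Contains π τ
  arc⇒avoids arc {τ} c w x y z {h} (p , p↗ , order)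
    with x≤c , z≤c , c<y , c<w , τx<τy , τy<τz , crossing ← toWitness h =
    intervalℤₙ-noncrossing (arc (p c))
      (before x≤c) (before z≤c) (∉prefixLetters (p↗ c y c<y)) (∉prefixLetters (p↗ c w c<w))
      (to x y τx<τy) (to y z τy<τz) (Sum.map (to w x) (to z w) crossing)
    where
    to : ∀ s t → lookup τ s ℕ.< lookup τ t → π ⟨$⟩ʳ p s Fin.< π ⟨$⟩ʳ p t
    to s t = Equivalence.to (order s t)

    before : ∀ {s} → s ≡ c ⊎ s Fin.< c → prefixLetters π (p c) (π ⟨$⟩ʳ p s)
    before (inj₁ refl) = _ , ℕ.≤-refl , refl
    before (inj₂ s<c)  = _ , ℕ.<⇒≤ (p↗ _ c s<c) , refl

-- From unimodal to arc, and from arc to the ten patterns.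

unimodal⇒arc : ∀ (π : Permutation′ n) → 𝒰 n π → 𝒜⟨ ⟪ 2 , 1 , 4 , 3 ⟫ ∷ ⟪ 3 , 4 , 1 , 2 ⟫ ∷ [] ⟩ n π
unimodal⇒arc π (inj₁ int) = (λ j → intervalℤ⇒intervalℤₙ (int j)) ,
  -- The middle entries of 2143 and 3412 are 1 and 4, so the last entry lies between two entries to
  -- its left. In the suffix case the first entry serves in the same way.
  prefixConvex⇒avoids π conv 1F 2F 3F ∷ prefixConvex⇒avoids π conv 2F 1F 3F ∷ []
  where
  conv : PrefixConvex π
  conv = prefixIntervals⇒prefixConvex π int
unimodal⇒arc π (inj₂ int) = suffixConvex⇒arc π conv ,
  suffixConvex⇒avoids π conv 0F 1F 2F ∷ suffixConvex⇒avoids π conv 0F 2F 1F ∷ []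
  where
  conv : SuffixConvex π
  conv = suffixIntervals⇒suffixConvex π int

tenPatterns : List Pattern
tenPatterns =
    ⟪ 1 , 3 , 2 , 4 ⟫ ∷ ⟪ 1 , 3 , 4 , 2 ⟫ ∷ ⟪ 2 , 1 , 4 , 3 ⟫ ∷ ⟪ 2 , 4 , 1 , 3 ⟫
  ∷ ⟪ 2 , 4 , 3 , 1 ⟫ ∷ ⟪ 3 , 1 , 2 , 4 ⟫ ∷ ⟪ 3 , 1 , 4 , 2 ⟫ ∷ ⟪ 3 , 4 , 1 , 2 ⟫
  ∷ ⟪ 4 , 2 , 1 , 3 ⟫ ∷ ⟪ 4 , 2 , 3 , 1 ⟫ ∷ []

arc⇒avoidsTen : ∀ (π : Permutation′ n) →
  𝒜⟨ ⟪ 2 , 1 , 4 , 3 ⟫ ∷ ⟪ 3 , 4 , 1 , 2 ⟫ ∷ [] ⟩ n π → 𝒮⟨ tenPatterns ⟩ n π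
arc⇒avoidsTen π (arc , ¬2143 ∷ ¬3412 ∷ []) =
    -- The cut `1F` follows the second entry. The first two entries are 1, 3 or 2, 4; `y` marks the
    -- value between them and `w` the remaining one.
    arc⇒avoids π arc 1F 3F 0F 2F 1F
  ∷ arc⇒avoids π arc 1F 2F 0F 3F 1F
  ∷ ¬2143
  ∷ arc⇒avoids π arc 1F 2F 0F 3F 1F
  ∷ arc⇒avoids π arc 1F 3F 0F 2F 1F
  ∷ arc⇒avoids π arc 1F 3F 1F 2F 0F
  ∷ arc⇒avoids π arc 1F 2F 1F 3F 0F
  ∷ ¬3412
  ∷ arc⇒avoids π arc 1F 2F 1F 3F 0F
  ∷ arc⇒avoids π arc 1F 3F 1F 2F 0F
  ∷ []

-- From the ten patterns back to unimodality.

module _ {m} (π : Permutation′ (ℕ.suc m)) where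

  private
    π₁ πₙ : Fin (ℕ.suc m)
    π₁ = π ⟨$⟩ʳ zero
    πₙ = π ⟨$⟩ʳ fromℕ m

    after-first : ∀ {i} → π ⟨$⟩ʳ i ≢ π₁ → zero {m} Fin.< i
    after-first {zero}  πi≢π₁ = contradiction refl πi≢π₁
    after-first {suc _} _     = ℕ.z<s

    before-last : ∀ {i} → π ⟨$⟩ʳ i ≢ πₙ → i Fin.< fromℕ m
    before-last πi≢πₙ = ≤∧≢⇒< (≤fromℕ _) λ { refl → πi≢πₙ refl }

    letter-≢ : ∀ {i j} → i Fin.< j → π ⟨$⟩ʳ i ≢ π ⟨$⟩ʳ j
    letter-≢ i<j πi≡πj = Fin.<⇒≢ i<j (Injection.injective (↔⇒↣ π) πi≡πj)

    above : ∀ {i j} → i Fin.< j → ¬ (π ⟨$⟩ʳ j Fin.< π ⟨$⟩ʳ i) → π ⟨$⟩ʳ i Fin.< π ⟨$⟩ʳ j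
    above i<j πj≮πi = ≤∧≢⇒< (ℕ.≮⇒≥ πj≮πi) (letter-≢ i<j)

    below : ∀ {i j} → i Fin.< j → ¬ (π ⟨$⟩ʳ i Fin.< π ⟨$⟩ʳ j) → π ⟨$⟩ʳ j Fin.< π ⟨$⟩ʳ i
    below i<j πi≮πj = ≤∧≢⇒< (ℕ.≮⇒≥ πi≮πj) (letter-≢ i<j ∘ sym)

  -- In a violation `π s` is below `π i`, so `i` is not the first position. The first letter thus
  -- precedes the violation as entry 1, and the order of `s` and `t` selects the pattern.
  first-smallest : ¬ Contains π ⟪ 1 , 3 , 2 , 4 ⟫ → ¬ Contains π ⟪ 1 , 3 , 4 , 2 ⟫ →
    ¬ (∃[ x ] π ⟨$⟩ʳ x Fin.< π₁) → SuffixConvex π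
  first-smallest ¬1324 ¬1342 min {i} {s} {t} i<s i<t πs<πi πi<πt
    with 0<i ← after-first {i} (λ eq → min (s , subst (π ⟨$⟩ʳ s Fin.<_) eq πs<πi))
    with π₁<πs ← above (ℕ.<-trans 0<i i<s) (λ πs<π₁ → min (s , πs<π₁)) | <-cmp s t
  ... | tri< s<t _ _ = ¬1324 (occurrence π (zero ∷ i ∷ s ∷ t ∷ []) (0F ∷ 2F ∷ 1F ∷ 3F ∷ [])
    (0<i ∷ i<s ∷ s<t ∷ [-]) (π₁<πs ∷ πs<πi ∷ πi<πt ∷ [-]))
  ... | tri≈ _ refl _ = ℕ.<-asym πs<πi πi<πt
  ... | tri> _ _ t<s = ¬1342 (occurrence π (zero ∷ i ∷ t ∷ s ∷ []) (0F ∷ 3F ∷ 1F ∷ 2F ∷ [])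
    (0<i ∷ i<t ∷ t<s ∷ [-]) (π₁<πs ∷ πs<πi ∷ πi<πt ∷ [-]))

  first-largest : ¬ Contains π ⟪ 4 , 2 , 1 , 3 ⟫ → ¬ Contains π ⟪ 4 , 2 , 3 , 1 ⟫ →
    ¬ (∃[ x ] π₁ Fin.< π ⟨$⟩ʳ x) → SuffixConvex π
  first-largest ¬4213 ¬4231 max {i} {s} {t} i<s i<t πs<πi πi<πt
    with 0<i ← after-first {i} (λ eq → max (t , subst (Fin._< π ⟨$⟩ʳ t) eq πi<πt))
    -- `π t` is the largest of the three letters, so this one comparison places `π₁` above them all.
    with πt<π₁ ← below (ℕ.<-trans 0<i i<t) (λ π₁<πt → max (t , π₁<πt)) | <-cmp s t
  ... | tri< s<t _ _ = ¬4213 (occurrence π (zero ∷ i ∷ s ∷ t ∷ []) (2F ∷ 1F ∷ 3F ∷ 0F ∷ [])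
    (0<i ∷ i<s ∷ s<t ∷ [-]) (πs<πi ∷ πi<πt ∷ πt<π₁ ∷ [-]))
  ... | tri≈ _ refl _ = ℕ.<-asym πs<πi πi<πt
  ... | tri> _ _ t<s = ¬4231 (occurrence π (zero ∷ i ∷ t ∷ s ∷ []) (3F ∷ 1F ∷ 2F ∷ 0F ∷ [])
    (0<i ∷ i<t ∷ t<s ∷ [-]) (πs<πi ∷ πi<πt ∷ πt<π₁ ∷ [-]))

  last-smallest : ¬ Contains π ⟪ 2 , 4 , 3 , 1 ⟫ → ¬ Contains π ⟪ 4 , 2 , 3 , 1 ⟫ →
    ¬ (∃[ x ] π ⟨$⟩ʳ x Fin.< πₙ) → PrefixConvex π
  last-smallest ¬2431 ¬4231 min {s} {t} {k} s<k t<k πs<πk πk<πt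
    with k<n ← before-last {k} (λ eq → min (s , subst (π ⟨$⟩ʳ s Fin.<_) eq πs<πk))
    with πₙ<πs ← below (ℕ.<-trans s<k k<n) (λ πs<πₙ → min (s , πs<πₙ)) | <-cmp s t
  ... | tri< s<t _ _ = ¬2431 (occurrence π (s ∷ t ∷ k ∷ fromℕ m ∷ []) (3F ∷ 0F ∷ 2F ∷ 1F ∷ [])
    (s<t ∷ t<k ∷ k<n ∷ [-]) (πₙ<πs ∷ πs<πk ∷ πk<πt ∷ [-]))
  ... | tri≈ _ refl _ = ℕ.<-asym πs<πk πk<πt
  ... | tri> _ _ t<s = ¬4231 (occurrence π (t ∷ s ∷ k ∷ fromℕ m ∷ []) (3F ∷ 1F ∷ 2F ∷ 0F ∷ [])
    (t<s ∷ s<k ∷ k<n ∷ [-]) (πₙ<πs ∷ πs<πk ∷ πk<πt ∷ [-]))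

  last-largest : ¬ Contains π ⟪ 1 , 3 , 2 , 4 ⟫ → ¬ Contains π ⟪ 3 , 1 , 2 , 4 ⟫ →
    ¬ (∃[ x ] πₙ Fin.< π ⟨$⟩ʳ x) → PrefixConvex π
  last-largest ¬1324 ¬3124 max {s} {t} {k} s<k t<k πs<πk πk<πt
    with k<n ← before-last {k} (λ eq → max (t , subst (Fin._< π ⟨$⟩ʳ t) eq πk<πt))
    with πt<πₙ ← above (ℕ.<-trans t<k k<n) (λ πₙ<πt → max (t , πₙ<πt)) | <-cmp s t
  ... | tri< s<t _ _ = ¬1324 (occurrence π (s ∷ t ∷ k ∷ fromℕ m ∷ []) (0F ∷ 2F ∷ 1F ∷ 3F ∷ [])
    (s<t ∷ t<k ∷ k<n ∷ [-]) (πs<πk ∷ πk<πt ∷ πt<πₙ ∷ [-]))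
  ... | tri≈ _ refl _ = ℕ.<-asym πs<πk πk<πt
  ... | tri> _ _ t<s = ¬3124 (occurrence π (t ∷ s ∷ k ∷ fromℕ m ∷ []) (1F ∷ 2F ∷ 0F ∷ 3F ∷ [])
    (t<s ∷ s<k ∷ k<n ∷ [-]) (πs<πk ∷ πk<πt ∷ πt<πₙ ∷ [-]))

  -- The end letters play 2 and 3. The letters at `x` and `y` differ from both, hence stand strictly
  -- inside, and their order selects the pattern.
  ascending-ends : ¬ Contains π ⟪ 2 , 1 , 4 , 3 ⟫ → ¬ Contains π ⟪ 2 , 4 , 1 , 3 ⟫ →
    π₁ Fin.< πₙ → ∀ {x y} → π ⟨$⟩ʳ x Fin.< π₁ → ¬ (πₙ Fin.< π ⟨$⟩ʳ y)
  ascending-ends ¬2143 ¬2413 π₁<πₙ {x} {y} πx<π₁ πₙ<πy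
    with 0<x ← after-first {x} (Fin.<⇒≢ πx<π₁)
       | 0<y ← after-first {y} (Fin.<⇒≢ (ℕ.<-trans π₁<πₙ πₙ<πy) ∘ sym)
       | x<n ← before-last {x} (Fin.<⇒≢ (ℕ.<-trans πx<π₁ π₁<πₙ))
       | y<n ← before-last {y} (Fin.<⇒≢ πₙ<πy ∘ sym)
       | <-cmp x y
  ... | tri< x<y _ _ = ¬2143 (occurrence π (zero ∷ x ∷ y ∷ fromℕ m ∷ []) (1F ∷ 0F ∷ 3F ∷ 2F ∷ [])
    (0<x ∷ x<y ∷ y<n ∷ [-]) (πx<π₁ ∷ π₁<πₙ ∷ πₙ<πy ∷ [-]))
  ... | tri≈ _ refl _ = ℕ.<-asym πx<π₁ (ℕ.<-trans π₁<πₙ πₙ<πy)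
  ... | tri> _ _ y<x = ¬2413 (occurrence π (zero ∷ y ∷ x ∷ fromℕ m ∷ []) (2F ∷ 0F ∷ 3F ∷ 1F ∷ [])
    (0<y ∷ y<x ∷ x<n ∷ [-]) (πx<π₁ ∷ π₁<πₙ ∷ πₙ<πy ∷ [-]))

  descending-ends : ¬ Contains π ⟪ 3 , 1 , 4 , 2 ⟫ → ¬ Contains π ⟪ 3 , 4 , 1 , 2 ⟫ →
    πₙ Fin.< π₁ → ∀ {x y} → π ⟨$⟩ʳ x Fin.< πₙ → ¬ (π₁ Fin.< π ⟨$⟩ʳ y)
  descending-ends ¬3142 ¬3412 πₙ<π₁ {x} {y} πx<πₙ π₁<πy
    with 0<x ← after-first {x} (Fin.<⇒≢ (ℕ.<-trans πx<πₙ πₙ<π₁))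
       | 0<y ← after-first {y} (Fin.<⇒≢ π₁<πy ∘ sym)
       | x<n ← before-last {x} (Fin.<⇒≢ πx<πₙ)
       | y<n ← before-last {y} (Fin.<⇒≢ (ℕ.<-trans πₙ<π₁ π₁<πy) ∘ sym)
       | <-cmp x y
  ... | tri< x<y _ _ = ¬3142 (occurrence π (zero ∷ x ∷ y ∷ fromℕ m ∷ []) (1F ∷ 3F ∷ 0F ∷ 2F ∷ [])
    (0<x ∷ x<y ∷ y<n ∷ [-]) (πx<πₙ ∷ πₙ<π₁ ∷ π₁<πy ∷ [-]))
  ... | tri≈ _ refl _ = ℕ.<-asym πx<πₙ (ℕ.<-trans πₙ<π₁ π₁<πy)
  ... | tri> _ _ y<x = ¬3412 (occurrence π (zero ∷ y ∷ x ∷ fromℕ m ∷ []) (2F ∷ 3F ∷ 0F ∷ 1F ∷ [])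
    (0<y ∷ y<x ∷ x<n ∷ [-]) (πx<πₙ ∷ πₙ<π₁ ∷ π₁<πy ∷ [-]))

  avoidsTen⇒unimodal : 𝒮⟨ tenPatterns ⟩ (ℕ.suc m) π → 𝒰 (ℕ.suc m) π
  avoidsTen⇒unimodal
    (¬1324 ∷ ¬1342 ∷ ¬2143 ∷ ¬2413 ∷ ¬2431 ∷ ¬3124 ∷ ¬3142 ∷ ¬3412 ∷ ¬4213 ∷ ¬4231 ∷ [])
    with any? (λ x → π ⟨$⟩ʳ x <? π₁) | any? (λ x → π₁ <? π ⟨$⟩ʳ x)
       | any? (λ x → π ⟨$⟩ʳ x <? πₙ) | any? (λ x → πₙ <? π ⟨$⟩ʳ x)
  ... | no min | _ | _ | _ =
    inj₂ (suffixConvex⇒suffixIntervals π (first-smallest ¬1324 ¬1342 min))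
  ... | _ | no max | _ | _ =
    inj₂ (suffixConvex⇒suffixIntervals π (first-largest ¬4213 ¬4231 max))
  ... | _ | _ | no min | _ =
    inj₁ (prefixConvex⇒prefixIntervals π (last-smallest ¬2431 ¬4231 min))
  ... | _ | _ | _ | no max =
    inj₁ (prefixConvex⇒prefixIntervals π (last-largest ¬1324 ¬3124 max))
  -- The letter below both ends is `a`'s if `π₁` is the smaller end, otherwise `c`'s; the one above
  -- both is `d`'s or `b`'s accordingly.
  ... | yes (a , πa<π₁) | yes (_ , π₁<πb) | yes (_ , πc<πₙ) | yes (_ , πₙ<πd)
    with <-cmp π₁ πₙ
  ...   | tri< π₁<πₙ _ _ = contradiction πₙ<πd (ascending-ends ¬2143 ¬2413 π₁<πₙ πa<π₁)
  ...   | tri> _ _ πₙ<π₁ = contradiction π₁<πb (descending-ends ¬3142 ¬3412 πₙ<π₁ πc<πₙ)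
  -- Position `a` is strictly between the ends, so these are distinct positions and carry distinct
  -- letters.
  ...   | tri≈ _ π₁≡πₙ _ = contradiction π₁≡πₙ (letter-≢ (ℕ.<-trans
    (after-first {a} (Fin.<⇒≢ πa<π₁))
    (before-last (Fin.<⇒≢ πa<π₁ ∘ λ πa≡πₙ → trans πa≡πₙ (sym π₁≡πₙ)))))

proposition3p4 : (n : ℕ) → 1 ≤ n →
    (𝒰 n ≐ 𝒜⟨ ⟪ 2 , 1 , 4 , 3 ⟫ ∷ ⟪ 3 , 4 , 1 , 2 ⟫ ∷ [] ⟩ n)
    ×
    (𝒜⟨ ⟪ 2 , 1 , 4 , 3 ⟫ ∷ ⟪ 3 , 4 , 1 , 2 ⟫ ∷ [] ⟩ n ≐
    𝒮⟨ ⟪ 1 , 3 , 2 , 4 ⟫ ∷ ⟪ 1 , 3 , 4 , 2 ⟫ ∷ ⟪ 2 , 1 , 4 , 3 ⟫ ∷ ⟪ 2 , 4 , 1 , 3 ⟫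
    ∷ ⟪ 2 , 4 , 3 , 1 ⟫ ∷ ⟪ 3 , 1 , 2 , 4 ⟫ ∷ ⟪ 3 , 1 , 4 , 2 ⟫ ∷ ⟪ 3 , 4 , 1 , 2 ⟫
    ∷ ⟪ 4 , 2 , 1 , 3 ⟫ ∷ ⟪ 4 , 2 , 3 , 1 ⟫ ∷ [] ⟩ n)
proposition3p4 (ℕ.suc m) _ =
    -- Three inclusions form a cycle, and each converse is the composite of the other two.
    ( (λ {π} → unimodal⇒arc π)
    , (λ {π} → avoidsTen⇒unimodal π ∘ arc⇒avoidsTen π))
  , ( (λ {π} → arc⇒avoidsTen π)
    , (λ {π} → unimodal⇒arc π ∘ avoidsTen⇒unimodal π))
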